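{- For every $t\geq 1$, if a problem has a Las Vegas algorithm that runs in time $T$ and a corresponding $(s,\varepsilon)$-oblivious verifier (i.e., an $(s,\varepsilon)$-oblivious verifier for that algorithm) for $\varepsilon<2^{ -s/t}$, then the problem has a non-uniform deterministic algorithm that runs in time $T\cdot t$ and always outputs the correct answer.
   Context: Here $t$ is a number of repetitions (an integer), and $T$, $s:\mathbb{N}\to\mathbb{N}$, $\varepsilon:\mathbb{N}\to[0,1]$ are functions of the input size $N$. Las Vegas algorithm: a randomized algorithm that always runs in time at most $T(N)$ on inputs of size $N$, but may, with a small probability, return $\bot$; in any other case it returns a correct output, and we then say that it succeeds. Oblivious verifier: Suppose that $A$ is a randomized algorithm that on input $x\in\{0,1\}^N$ uses $p(N)$ random bits. An $(s,\varepsilon)$-oblivious verifier for $A$ is a deterministic procedure (with no bound on its running time) that gets as input $N$, a sketch $\hat{x}\in\{0,1\}^{s(N)}$ and $r\in\{0,1\}^{p(N)}$, either accepts or rejects, and satisfies the following: (i) every $x\in\{0,1\}^N$ has a sketch $\hat{x}\in\{0,1\}^{s(N)}$ (depending on $x$ but not on $r$; it need not be efficiently computable); (ii) for every $x\in\{0,1\}^N$ with sketch $\hat{x}$ and every $r\in\{0,1\}^{p(N)}$, if the verifier accepts on $\hat{x}$ and $r$, then $A$ succeeds on $x$ and $r$; (iii) for every $x\in\{0,1\}^N$ with sketch $\hat{x}$, the probability over uniform $r\in\{0,1\}^{p(N)}$ that the verifier rejects on $\hat x$ and $r$ is at most $\varepsilon(N)$. A non-uniform algorithm that runs in time $t(n)$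 is given, on inputs of size $n$, an advice string $a(n)$ of size at most $t(n)$ that depends on $n$ but not on the input, and runs in time $t(n)$ given the input and the advice (equivalently, it is a sequence of Boolean circuits of size at most $t(n)$). -}

module Defs where

open import Data.Bool using (Bool; true; false; if_then_else_)
open import Data.Empty using (⊥)
open import Data.Integer using (+_)
open import Data.List using (List; []; _∷_; length; map; upTo)
open import Data.Nat as ℕ using (ℕ; zero; suc; NonZero; _≡ᵇ_; _≤ᵇ_)
open import Data.Nat.Properties using (m^n≢0)
open import Data.Product using (∃; _×_; _,_)
open import Data.Rational as ℚ using (ℚ; 0ℚ; 1ℚ; _/_; _<_; _≤_; _*_)
import Data.Rational.Properties as ℚₚ
open import Data.Sum using (_⊎_; inj₁; inj₂)
open import Data.Vec as Vec using (Vec; toList)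
open import Level renaming (suc to lsuc) using ()
open import Relation.Binary.PropositionalEquality
  using (_≡_; _≢_; subst)
open import Relation.Nullary using (yes; no)
open import Algebra.Definitions.RawSemiring ℚ.+-*-rawSemiring using (_^_)

------------------------------------------------------------------------
-- Real numbers (Dedekind cuts of ℚ)

record ℝ : Set₁ where
  field
    Lower Upper   : ℚ → Set
    lower-inhab   : ∃ Lower
    upper-inhab   : ∃ Upper
    lower-closed  : ∀ {q r} → q < r → Lower r → Lower q
    upper-closed  : ∀ {q r} → q < r → Upper q → Upper r
    lower-open    : ∀ {q} → Lower q → ∃ λ r → q < r × Lower r
    upper-open    : ∀ {q} → Upper q → ∃ λ r → r < q × Upper r
    disjoint      : ∀ {q} → Lower q → Upper q → ⊥
    located       : ∀ {q r} → q < r → Lower q ⊎ Upper r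

open ℝ public

infix 4 _≤ᴿ_ _<ᴿ_

_≤ᴿ_ : ℝ → ℝ → Set
x ≤ᴿ y = ∀ {q} → Lower x q → Lower y q

_<ᴿ_ : ℝ → ℝ → Set
x <ᴿ y = ∃ λ q → Upper x q × Lower y q

fromℚ : ℚ → ℝ
fromℚ p = record
  { Lower        = _< p
  ; Upper        = p <_
  ; lower-inhab  = p ℚ.- 1ℚ , p-1<p
  ; upper-inhab  = p ℚ.+ 1ℚ , p<p+1
  ; lower-closed = ℚₚ.<-trans
  ; upper-closed = λ q<r p<q → ℚₚ.<-trans p<q q<r
  ; lower-open   = λ q<p → let m , q<m , m<p = ℚₚ.<-dense q<p in m , q<m , m<p
  ; upper-open   = λ p<q → let m , p<m , m<q = ℚₚ.<-dense p<q in m , m<q , p<m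
  ; disjoint     = ℚₚ.<-asym
  ; located      = loc
  }
  where
  p-1<p : p ℚ.- 1ℚ < p
  p-1<p = subst (p ℚ.- 1ℚ <_) (ℚₚ.+-identityʳ p)
            (ℚₚ.+-monoʳ-< p (ℚₚ.negative⁻¹ (ℚ.- 1ℚ)))
  p<p+1 : p < p ℚ.+ 1ℚ
  p<p+1 = subst (_< p ℚ.+ 1ℚ) (ℚₚ.+-identityʳ p)
            (ℚₚ.+-monoʳ-< p (ℚₚ.positive⁻¹ 1ℚ))
  loc : ∀ {q r} → q < r → q < p ⊎ p < r
  loc {q} {r} q<r with q ℚₚ.<? p
  ... | yes q<p = inj₁ q<p
  ... | no  q≮p = inj₂ (ℚₚ.≤-<-trans (ℚₚ.≮⇒≥ q≮p) q<r)

2ℚ : ℚ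
2ℚ = + 2 / 1

private
  1≤2 : 1ℚ ≤ 2ℚ
  1≤2 = ℚₚ.<⇒≤ (ℚₚ.+-monoʳ-< 1ℚ (ℚₚ.positive⁻¹ 1ℚ))

  *-mono-≤ : ∀ {p q r s} → 0ℚ ≤ q → 0ℚ ≤ r → p ≤ q → r ≤ s → p * r ≤ q * s
  *-mono-≤ {p} {q} {r} {s} 0≤q 0≤r p≤q r≤s = ℚₚ.≤-trans
    (ℚₚ.*-monoʳ-≤-nonNeg r {{ℚ.nonNegative 0≤r}} p≤q)
    (ℚₚ.*-monoˡ-≤-nonNeg q {{ℚ.nonNegative 0≤q}} r≤s)

  ^-nonneg : ∀ {p} → 0ℚ ≤ p → ∀ n → 0ℚ ≤ p ^ n
  ^-nonneg 0≤p zero    = ℚₚ.<⇒≤ (ℚₚ.positive⁻¹ 1ℚ)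
  ^-nonneg {p} 0≤p (suc n) = subst (_≤ p * p ^ n) (ℚₚ.*-zeroˡ 0ℚ)
    (*-mono-≤ 0≤p ℚₚ.≤-refl 0≤p (^-nonneg 0≤p n))

  ^-mono-≤ : ∀ {p q} → 0ℚ ≤ p → p ≤ q → ∀ n → p ^ n ≤ q ^ n
  ^-mono-≤ 0≤p p≤q zero    = ℚₚ.≤-refl
  ^-mono-≤ 0≤p p≤q (suc n) =
    *-mono-≤ (ℚₚ.≤-trans 0≤p p≤q) (^-nonneg 0≤p n) p≤q (^-mono-≤ 0≤p p≤q n)

  ^-mono-< : ∀ {p q} → 0ℚ ≤ p → p < q → ∀ n → p ^ suc n < q ^ suc n
  ^-mono-< {p} {q} 0≤p p<q zero
    rewrite ℚₚ.*-identityʳ p | ℚₚ.*-identityʳ q = p<q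
  ^-mono-< {p} {q} 0≤p p<q (suc n) = ℚₚ.≤-<-trans
    (ℚₚ.*-monoʳ-≤-nonNeg (p ^ suc n)
       {{ℚ.nonNegative (^-nonneg 0≤p (suc n))}} (ℚₚ.<⇒≤ p<q))
    (ℚₚ.*-monoʳ-<-pos q {{ℚ.positive (ℚₚ.≤-<-trans 0≤p p<q)}}
       (^-mono-< 0≤p p<q n))

  1≤2^ : ∀ n → 1ℚ ≤ 2ℚ ^ n
  1≤2^ zero    = ℚₚ.≤-refl
  1≤2^ (suc n) = *-mono-≤ (ℚₚ.≤-trans 0≤1 1≤2) 0≤1 1≤2 (1≤2^ n)
    where
    0≤1 : 0ℚ ≤ 1ℚ
    0≤1 = ℚₚ.<⇒≤ (ℚₚ.positive⁻¹ 1ℚ)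

-- The real 2^(-s/t), as the cut at the positive solution y of y^t · 2^s = 1.
-- Quantifying over a rational strictly on the near side of the cut makes both
-- halves open and covers negative q.
2^-[_/_] : (s t : ℕ) .{{_ : NonZero t}} → ℝ
2^-[ s / t@(suc k) ] = record
  { Lower        = L
  ; Upper        = U
  ; lower-inhab  = ℚ.- 1ℚ , 0ℚ , ℚₚ.negative⁻¹ (ℚ.- 1ℚ) , ℚₚ.≤-refl , 0-below
  ; upper-inhab  = 2ℚ ℚ.+ 1ℚ , 2ℚ , 2<3 , 0≤2 , 2-above
  ; lower-closed = λ q<r (y , r<y , rest) → y , ℚₚ.<-trans q<r r<y , rest
  ; upper-closed = λ q<r (y , y<q , rest) → y , ℚₚ.<-trans y<q q<r , rest
  ; lower-open   = λ (y , q<y , rest) →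
                     let m , q<m , m<y = ℚₚ.<-dense q<y in m , q<m , y , m<y , rest
  ; upper-open   = λ (y , y<q , rest) →
                     let m , y<m , m<q = ℚₚ.<-dense y<q in m , m<q , y , y<m , rest
  ; disjoint     = λ (y , q<y , 0≤y , y-below) (z , z<q , 0≤z , z-above) →
                     ℚₚ.<-asym y-below (ℚₚ.<-trans z-above (above-mono 0≤z (ℚₚ.<-trans z<q q<y)))
  ; located      = loc
  }
  where
  L U : ℚ → Set
  L q = ∃ λ y → q < y × 0ℚ ≤ y × y ^ t * 2ℚ ^ s < 1ℚ
  U q = ∃ λ y → y < q × 0ℚ ≤ y × 1ℚ < y ^ t * 2ℚ ^ s

  0<2^s : 0ℚ < 2ℚ ^ s
  0<2^s = ℚₚ.<-≤-trans (ℚₚ.positive⁻¹ 1ℚ) (1≤2^ s)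

  1<2 : 1ℚ < 2ℚ
  1<2 = ℚₚ.+-monoʳ-< 1ℚ (ℚₚ.positive⁻¹ 1ℚ)

  0≤1 : 0ℚ ≤ 1ℚ
  0≤1 = ℚₚ.<⇒≤ (ℚₚ.positive⁻¹ 1ℚ)

  0≤2 : 0ℚ ≤ 2ℚ
  0≤2 = ℚₚ.≤-trans 0≤1 1≤2

  2<3 : 2ℚ < 2ℚ ℚ.+ 1ℚ
  2<3 = ℚₚ.+-monoʳ-< 2ℚ (ℚₚ.positive⁻¹ 1ℚ)

  0-below : 0ℚ ^ t * 2ℚ ^ s < 1ℚ
  0-below rewrite ℚₚ.*-zeroˡ (0ℚ ^ k) | ℚₚ.*-zeroˡ (2ℚ ^ s) = ℚₚ.positive⁻¹ 1ℚ

  2-above : 1ℚ < 2ℚ ^ t * 2ℚ ^ s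
  2-above = ℚₚ.<-≤-trans 1<2 (*-mono-≤ {2ℚ} {2ℚ ^ t} {1ℚ} (^-nonneg 0≤2 t) 0≤1
              (*-mono-≤ {2ℚ} {2ℚ} {1ℚ} 0≤2 0≤1 ℚₚ.≤-refl (1≤2^ k)) (1≤2^ s))

  above-mono : ∀ {y z} → 0ℚ ≤ y → y < z → y ^ t * 2ℚ ^ s < z ^ t * 2ℚ ^ s
  above-mono 0≤y y<z = ℚₚ.*-monoˡ-<-pos (2ℚ ^ s) {{ℚ.positive 0<2^s}} (^-mono-< 0≤y y<z k)

  loc : ∀ {q r} → q < r → L q ⊎ U r
  loc {q} {r} q<r with q ℚₚ.<? 0ℚ
  ... | yes q<0 = inj₁ (0ℚ , q<0 , ℚₚ.≤-refl , 0-below)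
  ... | no  q≮0 with ℚₚ.<-dense q<r
  ...   | n , q<n , n<r with ℚₚ.<-dense q<n
  ...     | m , q<m , m<n with (m ^ t * 2ℚ ^ s) ℚₚ.<? 1ℚ
  ...       | yes m-below = inj₁ (m , q<m , 0≤m , m-below)
    where
    0≤m : 0ℚ ≤ m
    0≤m = ℚₚ.≤-trans (ℚₚ.≮⇒≥ q≮0) (ℚₚ.<⇒≤ q<m)
  ...       | no  m≮      = inj₂ (n , n<r , ℚₚ.≤-trans 0≤m (ℚₚ.<⇒≤ m<n) ,
                                  ℚₚ.≤-<-trans (ℚₚ.≮⇒≥ m≮) (above-mono 0≤m m<n))
    where
    0≤m : 0ℚ ≤ m
    0≤m = ℚₚ.≤-trans (ℚₚ.≮⇒≥ q≮0) (ℚₚ.<⇒≤ q<m)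

------------------------------------------------------------------------
-- Probability over uniformly random bit strings

count : ∀ n → (Vec Bool n → Bool) → ℕ
count zero    E = if E Vec.[] then 1 else 0
count (suc n) E = count n (λ r → E (false Vec.∷ r)) ℕ.+ count n (λ r → E (true Vec.∷ r))

Pr : ∀ n → (Vec Bool n → Bool) → ℚ
Pr n E = (+ count n E / (2 ℕ.^ n)) {{m^n≢0 2 n}}

------------------------------------------------------------------------
-- Machine model

-- A unit-cost random access machine over ℕ without multiplication (in the
-- style of Cook and Reckhow).  It reads two read-only bit strings with random
-- access: the input, and an auxiliary string, which is the string of random
-- bits of a randomized algorithm and the advice of a non-uniform one.
-- Machines are uniform: one program serves all input sizes.

-- c ·[ a ]+ e denotes the address c · M[a] + e, where M is the memory and c, e
-- are constants of the program.  The constant scaling factor affects running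
-- times by constant factors only; it is there so that the time T · t can be
-- taken exactly rather than up to a constant.
record Address : Set where
  constructor _·[_]+_
  field
    scale base offset : ℕ

data Instr : Set where
  const      : (d n : ℕ) → Instr                  -- M[d] := n
  add sub    : (d a b : ℕ) → Instr                -- M[d] := M[a] + M[b], M[a] ∸ M[b]
  size       : (d : ℕ) → Instr                    -- M[d] := number of input bits
  load       : (d : ℕ) → Address → Instr          -- M[d] := M[α]
  store      : Address → (a : ℕ) → Instr          -- M[α] := M[a]
  input aux  : (d : ℕ) → Address → Instr          -- M[d] := bit α of that string
  jump       : (ℓ : ℕ) → Instr
  jumpIfZero : (a ℓ : ℕ) → Instr                  -- jump to ℓ if M[a] = 0
  fail       : Instr                              -- halt with ⊥
  -- Halt, with the output consisting of M[b] bits, the k-th one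
  -- (k = 0, 1, …) being 1 iff M[c · k + e] ≠ 0.
  return     : (c e b : ℕ) → Instr

Program : Set
Program = List Instr

Memory : Set
Memory = ℕ → ℕ

address : Memory → Address → ℕ
address M (c ·[ a ]+ e) = c ℕ.* M a ℕ.+ e

_[_≔_] : Memory → ℕ → ℕ → Memory
(M [ d ≔ v ]) a = if a ≡ᵇ d then v else M a

-- Reads past the end yield 0.
bitAt : List Bool → ℕ → ℕ
bitAt []       _       = 0
bitAt (b ∷ _)  zero    = if b then 1 else 0
bitAt (_ ∷ bs) (suc i) = bitAt bs i

fetch : Program → ℕ → (absent : Instr) → Instr
fetch []       _       absent = absent
fetch (i ∷ _)  zero    absent = i
fetch (_ ∷ is) (suc ℓ) absent = fetch is ℓ absent

data Outcome : Set where
  running : Outcome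
  ⊥-out   : Outcome
  output  : List Bool → Outcome

module _ (P : Program) (x r : List Bool) where

  -- runFrom τ ℓ M is the status, after τ time units, of the machine started at
  -- instruction ℓ with memory M.  An instruction takes one unit, and return one
  -- more for each output bit.  A machine whose instruction counter leaves the
  -- program loops there and never halts.
  runFrom : (τ ℓ : ℕ) → Memory → Outcome
  runFrom zero    ℓ M = running
  runFrom (suc τ) ℓ M with fetch P ℓ (jump ℓ)
  ... | const d n      = runFrom τ (suc ℓ) (M [ d ≔ n ])
  ... | add d a b      = runFrom τ (suc ℓ) (M [ d ≔ M a ℕ.+ M b ])
  ... | sub d a b      = runFrom τ (suc ℓ) (M [ d ≔ M a ℕ.∸ M b ])
  ... | size d         = runFrom τ (suc ℓ) (M [ d ≔ length x ])
  ... | load d α       = runFrom τ (suc ℓ) (M [ d ≔ M (address M α) ])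
  ... | store α a      = runFrom τ (suc ℓ) (M [ address M α ≔ M a ])
  ... | input d α      = runFrom τ (suc ℓ) (M [ d ≔ bitAt x (address M α) ])
  ... | aux d α        = runFrom τ (suc ℓ) (M [ d ≔ bitAt r (address M α) ])
  ... | jump ℓ′        = runFrom τ ℓ′ M
  ... | jumpIfZero a ℓ′ = runFrom τ (if M a ≡ᵇ 0 then ℓ′ else suc ℓ) M
  ... | fail           = ⊥-out
  ... | return c e b   =
    if M b ≤ᵇ τ
    then output (map (λ k → if M (c ℕ.* k ℕ.+ e) ≡ᵇ 0 then false else true) (upTo (M b)))
    else running

  run : (τ : ℕ) → Outcome
  run τ = runFrom τ 0 (λ _ → 0)

------------------------------------------------------------------------
-- Problems and algorithms

-- Π x y: the output y is correct on the input x.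
Problem : ∀ ℓ → Set (lsuc ℓ)
Problem ℓ = ∀ {N} → Vec Bool N → List Bool → Set ℓ

record LasVegas {ℓ} (Π : Problem ℓ) (T : ℕ → ℕ) : Set ℓ where
  field
    program : Program
    coins   : ℕ → ℕ

  outcome : ∀ {N} → Vec Bool N → Vec Bool (coins N) → Outcome
  outcome {N} x r = run program (toList x) (toList r) (T N)

  field
    -- Drawing a random bit takes time, so at most T N of them are used.
    coins≤time : ∀ N → coins N ℕ.≤ T N
    halts      : ∀ {N} (x : Vec Bool N) r → outcome x r ≢ running
    correct    : ∀ {N} (x : Vec Bool N) r {y} → outcome x r ≡ output y → Π x y

  Succeeds : ∀ {N} → Vec Bool N → Vec Bool (coins N) → Set
  Succeeds x r = ∃ λ y → outcome x r ≡ output y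

record ObliviousVerifier {ℓ} {Π : Problem ℓ} {T} (A : LasVegas Π T)
                         (s : ℕ → ℕ) (ε : ℕ → ℝ) : Set where
  open LasVegas A
  field
    rejects : ∀ N → Vec Bool (s N) → Vec Bool (coins N) → Bool
    sketch  : ∀ {N} → Vec Bool N → Vec Bool (s N)
    sound   : ∀ {N} (x : Vec Bool N) r →
              rejects N (sketch x) r ≡ false → Succeeds x r
    error   : ∀ {N} (x : Vec Bool N) →
              fromℚ (Pr (coins N) (rejects N (sketch x))) ≤ᴿ ε N

record NonUniform {ℓ} (Π : Problem ℓ) (T : ℕ → ℕ) : Set ℓ where
  field
    program     : Program
    advice      : ℕ → List Bool
    advice-size : ∀ N → length (advice N) ℕ.≤ T N
    correct     : ∀ {N} (x : Vec Bool N) → ∃ λ y →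
                  run program (toList x) (advice N) (T N) ≡ output y × Π x y

{-# OPTIONS --safe #-}
-- Averaging over the sketches whose rejection probability is below 2^(-s/t),
-- some string of coins makes the verifier reject fewer than a 2^(-s/t) fraction
-- of them.  Repeating this t times on the sketches still rejected leaves fewer
-- than 2^s · 2^(-s) = 1, so there are coins r₀, …, r_{t-1} such that on every
-- input the algorithm succeeds with one of them.  They are the advice.
--
-- To run in time exactly T · t, the program consists of t copies of the given
-- one, where copy j keeps cell a in cell a · t + j (thus it starts from zeroed
-- memory), finds bit i of r_j at position i · t + j of the advice, and passes to
-- copy j + 1 where the given program fails.
module Submission where

open import Defs
open import Data.Nat using (ℕ; NonZero; _*_)
open import Data.Product using (_×_)
open import Data.Rational using (0ℚ; 1ℚ)
open import Algebra.Definitions.RawSemiring Data.Rational.+-*-rawSemiring using () renaming (_^_ to _^ℚ_)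
open import Data.Bool using (Bool; true; false; T; T?; if_then_else_)
open import Data.Fin using (Fin; zero; suc; toℕ; fromℕ<)
open import Data.Fin.Properties using (toℕ<n; toℕ-injective; toℕ-fromℕ<)
open import Data.Integer as ℤ using (+_; +≤+; +<+)
import Data.Integer.Properties as ℤₚ
open import Data.List using (List; []; _∷_; length; map; filter; filterᵇ; upTo; _++_)
open import Data.List.Membership.Propositional using (_∈_)
open import Data.List.Membership.Propositional.Properties using (∈-filter⁺; ∈-filter⁻; ∈-++⁺ˡ; ∈-++⁺ʳ; ∈-map⁺)
open import Data.List.Properties using (length-map; length-++; length-filter; map-cong)
open import Data.List.Relation.Unary.Any using (here; there)
open import Data.Nat as ℕ using (zero; suc; _+_; _∸_; _^_; _≤_; _<_; _≡ᵇ_; _≤ᵇ_; _≤?_; z≤n; s≤s)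
open import Data.Nat.DivMod using (_%_; [m+kn]%n≡m%n; m<n⇒m%n≡m)
open import Data.Nat.ListAction using (sum)
open import Data.Nat.Properties
open import Data.Nat.Solver using (module +-*-Solver)
open import Data.Product using (∃; ∃₂; _,_; proj₁; proj₂)
open import Data.Rational as ℚ using (mkℚ; toℚᵘ)
import Data.Rational.Properties as ℚₚ
open import Data.Rational.Unnormalised as ℚᵘ using (mkℚᵘ; 1ℚᵘ; _≃_; *≤*; *<*)
import Data.Rational.Unnormalised.Properties as ℚᵘₚ
open import Data.Sum using (inj₁; inj₂)
open import Data.Unit using (⊤; tt)
open import Data.Vec as Vec using (Vec; toList; lookup; head; tail)
open import Data.Vec.Properties using (lookup-map; length-toList)
open import Function using (_∘_)
open import Relation.Binary.PropositionalEquality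
open import Relation.Nullary using (yes; no; contradiction)

-- From the real bound to inequalities between natural numbers.

toℚᵘ-/ : ∀ n d .{{_ : NonZero d}} → toℚᵘ (+ n ℚ./ d) ≃ + n ℚᵘ./ d
toℚᵘ-/ n (suc d) = ℚₚ.toℚᵘ-fromℚᵘ (mkℚᵘ (+ n) d)

/-*-/ : ∀ a b c d .{{_ : NonZero b}} .{{_ : NonZero d}} .{{_ : NonZero (b * d)}} →
        (+ a ℚᵘ./ b) ℚᵘ.* (+ c ℚᵘ./ d) ≡ + (a * c) ℚᵘ./ (b * d)
/-*-/ a (suc b) c (suc d) = cong (ℚᵘ._/ (suc b * suc d)) (sym (ℤₚ.pos-* a c))

-- Unnormalised fractions are not reduced, so numerator and denominator can be raised to the power
-- separately.
toℚᵘ-^ : ∀ {p} a b .{{_ : NonZero b}} → toℚᵘ p ≃ + a ℚᵘ./ b →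
         ∀ n → toℚᵘ (p ^ℚ n) ≃ (+ (a ^ n) ℚᵘ./ (b ^ n)) {{m^n≢0 b n}}
toℚᵘ-^ a b p≃ zero = ℚᵘₚ.≃-refl
toℚᵘ-^ {p} a b p≃ (suc n) = begin
  toℚᵘ (p ℚ.* p ^ℚ n)                          ≈⟨ ℚₚ.toℚᵘ-homo-* p (p ^ℚ n) ⟩
  toℚᵘ p ℚᵘ.* toℚᵘ (p ^ℚ n)                    ≈⟨ ℚᵘₚ.*-cong p≃ (toℚᵘ-^ a b p≃ n) ⟩
  (+ a ℚᵘ./ b) ℚᵘ.* (+ (a ^ n) ℚᵘ./ (b ^ n))   ≡⟨ /-*-/ a b (a ^ n) (b ^ n) ⟩
  + (a ^ suc n) ℚᵘ./ (b ^ suc n)               ∎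
  where
  open ℚᵘₚ.≃-Reasoning
  instance
    _ = m^n≢0 b n
    _ = m^n≢0 b (suc n)

/<1⇒< : ∀ n d .{{_ : NonZero d}} → + n ℚᵘ./ d ℚᵘ.< 1ℚᵘ → n < d
/<1⇒< n (suc d) (*<* lt) with subst₂ ℤ._<_ (ℤₚ.*-identityʳ (+ n)) (ℤₚ.*-identityˡ (+ suc d)) lt
... | +<+ n<d = n<d

/≤/⇒*≤* : ∀ a b c d .{{_ : NonZero b}} .{{_ : NonZero d}} →
          + a ℚᵘ./ b ℚᵘ.≤ + c ℚᵘ./ d → a * d ≤ c * b
/≤/⇒*≤* a (suc b) c (suc d) (*≤* le)
  with subst₂ ℤ._≤_ (sym (ℤₚ.pos-* a (suc d))) (sym (ℤₚ.pos-* c (suc b))) le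
... | +≤+ le′ = le′

nonNeg-fraction : ∀ p → 0ℚ ℚ.≤ p → ∃₂ λ a b → toℚᵘ p ≡ + a ℚᵘ./ suc b
nonNeg-fraction p@(mkℚ (+ a) b _) _ = a , b , refl
nonNeg-fraction (mkℚ ℤ.-[1+ _ ] _ _) (ℚ.*≤* ())

^*2^<1 : ∀ {p} a b .{{_ : NonZero b}} → toℚᵘ p ≃ + a ℚᵘ./ b → ∀ t s →
         p ^ℚ t ℚ.* 2ℚ ^ℚ s ℚ.< 1ℚ → a ^ t * 2 ^ s < b ^ t
^*2^<1 {p} a b p≃ t s lt = subst (a ^ t * 2 ^ s <_)
  -- `2ℚ` is the fraction 2/1, whose power leaves the factor `1 ^ s` in the denominator.
  (trans (cong (b ^ t *_) (^-zeroˡ s)) (*-identityʳ (b ^ t)))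
  (/<1⇒< _ _ (ℚᵘₚ.<-respˡ-≃ eq (ℚₚ.toℚᵘ-mono-< lt)))
  where
  open ℚᵘₚ.≃-Reasoning
  instance
    _ = m^n≢0 b t
    _ = m^n≢0 1 s
    _ = m*n≢0 (b ^ t) (1 ^ s)
  eq : toℚᵘ (p ^ℚ t ℚ.* 2ℚ ^ℚ s) ≃ + (a ^ t * 2 ^ s) ℚᵘ./ (b ^ t * 1 ^ s)
  eq = begin
    toℚᵘ (p ^ℚ t ℚ.* 2ℚ ^ℚ s)          ≈⟨ ℚₚ.toℚᵘ-homo-* (p ^ℚ t) (2ℚ ^ℚ s) ⟩
    toℚᵘ (p ^ℚ t) ℚᵘ.* toℚᵘ (2ℚ ^ℚ s)
      ≈⟨ ℚᵘₚ.*-cong (toℚᵘ-^ {p} a b p≃ t) (toℚᵘ-^ {2ℚ} 2 1 ℚᵘₚ.≃-refl s) ⟩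
    (+ (a ^ t) ℚᵘ./ (b ^ t)) ℚᵘ.* (+ (2 ^ s) ℚᵘ./ (1 ^ s))
      ≡⟨ /-*-/ (a ^ t) (b ^ t) (2 ^ s) (1 ^ s) ⟩
    + (a ^ t * 2 ^ s) ℚᵘ./ (b ^ t * 1 ^ s) ∎

-- If `q < p`, then `q` would lie in both cuts of `x`.
fromℚ≤∧<⇒≤ : ∀ {p q} x → fromℚ p ≤ᴿ x → Upper x q → p ℚ.≤ q
fromℚ≤∧<⇒≤ {p} {q} x p≤x x<q with q ℚₚ.<? p
... | yes q<p = contradiction x<q (disjoint x (p≤x q<p))
... | no  q≮p = ℚₚ.≮⇒≥ q≮p

-- The fraction a/(b+1) is the witness `y` for the lower cut of 2^(-s/t), taken above a rational `q`
-- in the upper cut of `x`. It is chosen before `E`, so one fraction bounds the rejection counts of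
-- all sketches at once.
fraction-below-2^- : ∀ t .{{_ : NonZero t}} s {x} → x <ᴿ 2^-[ s / t ] →
  ∃₂ λ a b → a ^ t * 2 ^ s < suc b ^ t ×
    (∀ n E → fromℚ (Pr n E) ≤ᴿ x → count n E * suc b ≤ a * 2 ^ n)
fraction-below-2^- (suc t) s {x} (q , x<q , y , q<y , 0≤y , lt)
  with nonNeg-fraction y 0≤y
... | a , b , eq = a , b
  , ^*2^<1 {y} a (suc b) (ℚᵘₚ.≃-reflexive eq) (suc t) s lt
  , λ n E Pr≤x → let instance _ = m^n≢0 2 n in
      /≤/⇒*≤* (count n E) (2 ^ n) a (suc b)
        (ℚᵘₚ.≤-respˡ-≃ (toℚᵘ-/ (count n E) (2 ^ n))
          (ℚᵘₚ.≤-respʳ-≃ (ℚᵘₚ.≃-reflexive eq)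
            (ℚₚ.toℚᵘ-mono-≤
              (ℚₚ.≤-trans (fromℚ≤∧<⇒≤ x Pr≤x x<q) (ℚₚ.<⇒≤ q<y)))))

-- Coin strings that hit all sketches, by averaging.

bitStrings : ∀ n → List (Vec Bool n)
bitStrings zero    = Vec.[] ∷ []
bitStrings (suc n) = map (false Vec.∷_) (bitStrings n) ++ map (true Vec.∷_) (bitStrings n)

length-bitStrings : ∀ n → length (bitStrings n) ≡ 2 ^ n
length-bitStrings zero    = refl
length-bitStrings (suc n) = begin
  length (map (false Vec.∷_) (bitStrings n) ++ map (true Vec.∷_) (bitStrings n))
    ≡⟨ length-++ (map (false Vec.∷_) (bitStrings n)) ⟩
  length (map (false Vec.∷_) (bitStrings n)) + length (map (true Vec.∷_) (bitStrings n))
    ≡⟨ cong₂ _+_ (trans (length-map _ (bitStrings n)) (length-bitStrings n))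
                 (trans (length-map _ (bitStrings n)) (length-bitStrings n)) ⟩
  2 ^ n + 2 ^ n
    ≡⟨ cong (_+_ (2 ^ n)) (+-identityʳ (2 ^ n)) ⟨
  2 ^ suc n ∎
  where open ≡-Reasoning

∈-bitStrings : ∀ {n} (v : Vec Bool n) → v ∈ bitStrings n
∈-bitStrings Vec.[]          = here refl
∈-bitStrings (false Vec.∷ v) = ∈-++⁺ˡ (∈-map⁺ _ (∈-bitStrings v))
∈-bitStrings (true Vec.∷ v)  = ∈-++⁺ʳ _ (∈-map⁺ _ (∈-bitStrings v))

module _ {A : Set} where

  -- Double counting: the pairs of `r` and an entry `σ` of `S` with `R r σ` are counted entry by
  -- entry, where the error bound applies (`total-bound`); `below-average` turns the result into a
  -- good `r`.
  total : ∀ n → (Vec Bool n → A → Bool) → List A → ℕ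
  total n R = sum ∘ map (λ σ → count n (λ r → R r σ))

  total-zero : ∀ R S → total 0 R S ≡ length (filterᵇ (R Vec.[]) S)
  total-zero R []      = refl
  total-zero R (σ ∷ S) with R Vec.[] σ
  ... | true  = cong suc (total-zero R S)
  ... | false = total-zero R S

  total-suc : ∀ n R S → total (suc n) R S ≡
              total n (R ∘ (false Vec.∷_)) S + total n (R ∘ (true Vec.∷_)) S
  total-suc n R []      = refl
  total-suc n R (σ ∷ S) = trans (cong (_+_ (count (suc n) (λ r → R r σ))) (total-suc n R S))
    (solve 4 (λ a b c d → (a :+ b) :+ (c :+ d) := (a :+ c) :+ (b :+ d)) refl
       (count n (λ r → R (false Vec.∷ r) σ)) (count n (λ r → R (true Vec.∷ r) σ)) _ _)
    where open +-*-Solver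

  -- The method of conditional expectations: one of the two values of the first
  -- coin does not increase the average.
  below-average : ∀ n R S b K → total n R S * b ≤ K * 2 ^ n →
                  ∃ λ r → length (filterᵇ (R r) S) * b ≤ K
  below-average zero    R S b K le =
    Vec.[] , subst₂ _≤_ (cong (_* b) (total-zero R S)) (*-identityʳ K) le
  below-average (suc n) R S b K le
    with total n (R ∘ (false Vec.∷_)) S * b ≤? K * 2 ^ n
  ... | yes le₀ = let r , p = below-average n _ S b K le₀ in false Vec.∷ r , p
  ... | no  gt₀ with total n (R ∘ (true Vec.∷_)) S * b ≤? K * 2 ^ n
  ...   | yes le₁ = let r , p = below-average n _ S b K le₁ in true Vec.∷ r , p
  ...   | no  gt₁ = contradiction
    (subst₂ _≤_
      (trans (cong (_* b) (total-suc n R S)) (*-distribʳ-+ b (total n (R ∘ (false Vec.∷_)) S) _))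
      (solve 2 (λ k m → k :* (con 2 :* m) := k :* m :+ k :* m) refl K (2 ^ n))
      le)
    (<⇒≱ (+-mono-< (≰⇒> gt₀) (≰⇒> gt₁)))
    where open +-*-Solver

  total-bound : ∀ n R S b c → (∀ {σ} → σ ∈ S → count n (λ r → R r σ) * b ≤ c) →
                total n R S * b ≤ length S * c
  total-bound n R []      b c le = z≤n
  total-bound n R (σ ∷ S) b c le = ≤-trans
    (≤-reflexive (*-distribʳ-+ b (count n (λ r → R r σ)) _))
    (+-mono-≤ (le (here refl)) (total-bound n R S b c (le ∘ there)))

  -- Induction on `t`. The last hypothesis says that (a/(b+1))^t times the length of `S` is below 1.
  -- An `r` that is no worse than average rejects at most an a/(b+1) fraction of `S`, so the
  -- inequality passes to the rejected entries with one factor fewer. At `t = 0` it forces `S` to be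
  -- empty.
  hitting : ∀ n (R : Vec Bool n → A → Bool) a b t (S : List A) →
            (∀ {σ} → σ ∈ S → count n (λ r → R r σ) * suc b ≤ a * 2 ^ n) →
            a ^ t * length S < suc b ^ t →
            ∃ λ (rs : Vec (Vec Bool n) t) →
              ∀ {σ} → σ ∈ S → ∃ λ j → R (lookup rs j) σ ≡ false
  hitting n R a b zero    []      le lt = Vec.[] , λ ()
  hitting n R a b zero    (_ ∷ _) le (s≤s ())
  hitting n R a b (suc t) S       le lt = r Vec.∷ rs , hits
    where
    open +-*-Solver
    chosen : ∃ λ r → length (filterᵇ (R r) S) * suc b ≤ length S * a
    chosen = below-average n R S (suc b) (length S * a)
      (≤-trans (total-bound n R S (suc b) (a * 2 ^ n) le)
        (≤-reflexive (sym (*-assoc (length S) a (2 ^ n)))))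
    r  = proj₁ chosen
    S′ = filterᵇ (R r) S
    lt′ : a ^ t * length S′ < suc b ^ t
    lt′ = *-cancelʳ-< (suc b) _ _ (begin-strict
      a ^ t * length S′ * suc b    ≡⟨ *-assoc (a ^ t) _ _ ⟩
      a ^ t * (length S′ * suc b)  ≤⟨ *-monoʳ-≤ (a ^ t) (proj₂ chosen) ⟩
      a ^ t * (length S * a)       ≡⟨ solve 3 (λ x y z → x :* (y :* z) := z :* x :* y) refl (a ^ t) (length S) a ⟩
      a ^ suc t * length S         <⟨ lt ⟩
      suc b ^ suc t                ≡⟨ *-comm (suc b) _ ⟩
      suc b ^ t * suc b            ∎)
      where open ≤-Reasoning
    rest = hitting n R a b t S′ (le ∘ proj₁ ∘ ∈-filter⁻ (T? ∘ R r)) lt′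
    rs = proj₁ rest
    hits : ∀ {σ} → σ ∈ S → ∃ λ j → R (lookup (r Vec.∷ rs) j) σ ≡ false
    hits {σ} σ∈S with R r σ in eq
    ... | false = zero , eq
    ... | true  = let j , p = proj₂ rest (∈-filter⁺ (T? ∘ R r) σ∈S (subst T (sym eq) tt)) in suc j , p

-- A string `σ` that is not the sketch of any input may be rejected arbitrarily often. Hence
-- `hitting` is applied only to those `σ` that satisfy the bound, of which there are at most
-- `2 ^ s`.
common-coins : ∀ {s n t} a b (R : Vec Bool s → Vec Bool n → Bool) →
  a ^ t * 2 ^ s < suc b ^ t →
  ∃ λ (rs : Vec (Vec Bool n) t) → ∀ σ → count n (R σ) * suc b ≤ a * 2 ^ n →
    ∃ λ j → R σ (lookup rs j) ≡ false
common-coins {s} {n} {t} a b R lt =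
  let rs , hits = hitting n (λ r σ → R σ r) a b t rare
                    (proj₂ ∘ ∈-filter⁻ rare? {xs = bitStrings s})
                    (≤-<-trans (*-monoʳ-≤ (a ^ t) length-rare) lt)
  in rs , λ σ le → hits (∈-filter⁺ rare? (∈-bitStrings σ) le)
  where
  rare? = λ σ → count n (R σ) * suc b ≤? a * 2 ^ n
  rare  = filter rare? (bitStrings s)
  length-rare : length rare ≤ 2 ^ s
  length-rare = subst (length rare ≤_) (length-bitStrings s) (length-filter rare? (bitStrings s))

-- The layout of the advice.

bitAt-++ˡ : ∀ {n} (v : Vec Bool n) bs (i : Fin n) →
            bitAt (toList v ++ bs) (toℕ i) ≡ (if lookup v i then 1 else 0)
bitAt-++ˡ (b Vec.∷ v) bs zero    = refl
bitAt-++ˡ (b Vec.∷ v) bs (suc i) = bitAt-++ˡ v bs i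

bitAt-++ʳ : ∀ {n} (v : Vec Bool n) bs i → bitAt (toList v ++ bs) (n + i) ≡ bitAt bs i
bitAt-++ʳ Vec.[]      bs i = refl
bitAt-++ʳ (b Vec.∷ v) bs i = bitAt-++ʳ v bs i

-- The strings are stored transposed, in the layout that `cell` gives to memory, so that one
-- translation of addresses serves both `load` and `aux`.
interleave : ∀ {n t} → Vec (Vec Bool n) t → List Bool
interleave {zero}  rs = []
interleave {suc n} rs = toList (Vec.map head rs) ++ interleave (Vec.map tail rs)

length-interleave : ∀ {n t} (rs : Vec (Vec Bool n) t) → length (interleave rs) ≡ n * t
length-interleave {zero}  rs = refl
length-interleave {suc n} rs = trans (length-++ (toList (Vec.map head rs)))
  (cong₂ _+_ (length-toList (Vec.map head rs)) (length-interleave (Vec.map tail rs)))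

bitAt-interleave : ∀ {n t} (rs : Vec (Vec Bool n) t) j i →
                   bitAt (interleave rs) (i * t + toℕ j) ≡ bitAt (toList (lookup rs j)) i
-- Reads past the last coin end up here: the position then lies beyond the interleaving too, and
-- both sides are the default 0.
bitAt-interleave {zero} rs j i with lookup rs j
... | Vec.[] = refl
bitAt-interleave {suc n} {t} rs j zero with lookup rs j | lookup-map j head rs
... | b Vec.∷ _ | eq = trans (bitAt-++ˡ (Vec.map head rs) _ j) (cong (if_then 1 else 0) eq)
bitAt-interleave {suc n} {t} rs j (suc i) = begin
  bitAt (toList (Vec.map head rs) ++ interleave (Vec.map tail rs)) (t + i * t + toℕ j)
    ≡⟨ cong (bitAt (interleave rs)) (+-assoc t (i * t) (toℕ j)) ⟩
  bitAt (toList (Vec.map head rs) ++ interleave (Vec.map tail rs)) (t + (i * t + toℕ j))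
    ≡⟨ bitAt-++ʳ (Vec.map head rs) _ _ ⟩
  bitAt (interleave (Vec.map tail rs)) (i * t + toℕ j)
    ≡⟨ bitAt-interleave (Vec.map tail rs) j i ⟩
  bitAt (toList (lookup (Vec.map tail rs) j)) i
    ≡⟨ cong (λ v → bitAt (toList v) i) (lookup-map j tail rs) ⟩
  bitAt (toList (tail (lookup rs j))) i
    ≡⟨ bitAt-tail (lookup rs j) ⟩
  bitAt (toList (lookup rs j)) (suc i) ∎
  where
  open ≡-Reasoning
  bitAt-tail : (v : Vec Bool (suc n)) → bitAt (toList (tail v)) i ≡ bitAt (toList v) (suc i)
  bitAt-tail (_ Vec.∷ _) = refl

-- Fetching instructions and updating memory.

-- The defaults `i` and `i′` may differ because `runFrom` uses a jump to the current counter, which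
-- is not the same in a program and in its copy.
fetch-++ˡ : ∀ P Q {ℓ i i′} → ℓ < length P → fetch (P ++ Q) ℓ i ≡ fetch P ℓ i′
fetch-++ˡ (_ ∷ P) Q {zero}  _         = refl
fetch-++ˡ (_ ∷ P) Q {suc ℓ} (s≤s ℓ<) = fetch-++ˡ P Q ℓ<

fetch-++ʳ : ∀ P Q {ℓ i} → fetch (P ++ Q) (length P + ℓ) i ≡ fetch Q ℓ i
fetch-++ʳ []      Q = refl
fetch-++ʳ (_ ∷ P) Q = fetch-++ʳ P Q

fetch-map : ∀ f P {ℓ i i′} → ℓ < length P → fetch (map f P) ℓ i ≡ f (fetch P ℓ i′)
fetch-map f (_ ∷ P) {zero}  _        = refl
fetch-map f (_ ∷ P) {suc ℓ} (s≤s ℓ<) = fetch-map f P ℓ<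

fetch-≥ : ∀ P {ℓ i} → length P ≤ ℓ → fetch P ℓ i ≡ i
fetch-≥ []      _        = refl
fetch-≥ (_ ∷ P) (s≤s le) = fetch-≥ P le

-- The default instruction is a jump to the counter itself, so the counter stays where it is.
runFrom-≥ : ∀ P x r τ {ℓ M} → length P ≤ ℓ → runFrom P x r τ ℓ M ≡ running
runFrom-≥ P x r zero        le = refl
runFrom-≥ P x r (suc τ) {ℓ} le rewrite fetch-≥ P {i = jump ℓ} le = runFrom-≥ P x r τ le

≔-same : ∀ M {v} d → (M [ d ≔ v ]) d ≡ v
≔-same M d with d ≡ᵇ d | ≡⇒≡ᵇ d d refl
... | true | _ = refl

≔-other : ∀ M {v} {d a} → a ≢ d → (M [ d ≔ v ]) a ≡ M a
≔-other M {d = d} {a} a≢d with a ≡ᵇ d | ≡ᵇ⇒≡ a d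
... | true  | p = contradiction (p tt) a≢d
... | false | _ = refl

-- Copies of a program in disjoint cells.

module _ (t : ℕ) where

  cell : ℕ → ℕ → ℕ
  cell j a = a * t + j

  cell-% : ∀ {j} a → .{{_ : NonZero t}} → j < t → cell j a % t ≡ j
  cell-% {j} a j<t = trans (cong (_% t) (+-comm (a * t) j))
    (trans ([m+kn]%n≡m%n j a t) (m<n⇒m%n≡m j<t))

  cell-injectiveʳ : ∀ {j k a b} → j < t → k < t → cell j a ≡ cell k b → j ≡ k
  cell-injectiveʳ {j} {k} {a} {b} j<t k<t eq =
    trans (sym (cell-% a j<t)) (trans (cong (_% t) eq) (cell-% b k<t))
    where instance _ = ℕ.>-nonZero (≤-<-trans z≤n j<t)

  cell-injectiveˡ : ∀ {j a b} → j < t → cell j a ≡ cell j b → a ≡ b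
  cell-injectiveˡ {j} {a} {b} j<t eq = *-cancelʳ-≡ a b t (+-cancelʳ-≡ j (a * t) (b * t) eq)
    where instance _ = ℕ.>-nonZero (≤-<-trans z≤n j<t)

  -- A copied cell holds the original value `v`, so the scale takes the factor `t`:
  -- `c * t * v + (e * t + j)` is `(c * v + e) * t + j`. Translating an address thus costs no extra
  -- instruction.
  cellAddress : ℕ → Address → Address
  cellAddress j (c ·[ a ]+ e) = (c * t) ·[ cell j a ]+ cell j e

  module _ (L : ℕ) where

    -- One instruction becomes one instruction, so running times carry over exactly. The input is
    -- shared and not interleaved, hence `input` keeps its scale and offset. Copy `j` starts at
    -- `j * L`, so `fail` enters the next copy; in the last one it leaves the program.
    copyInstr : ℕ → Instr → Instr
    copyInstr j (const d n)           = const (cell j d) n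
    copyInstr j (add d a b)           = add (cell j d) (cell j a) (cell j b)
    copyInstr j (sub d a b)           = sub (cell j d) (cell j a) (cell j b)
    copyInstr j (size d)              = size (cell j d)
    copyInstr j (load d α)            = load (cell j d) (cellAddress j α)
    copyInstr j (store α a)           = store (cellAddress j α) (cell j a)
    copyInstr j (input d (c ·[ a ]+ e)) = input (cell j d) (c ·[ cell j a ]+ e)
    copyInstr j (aux d α)             = aux (cell j d) (cellAddress j α)
    copyInstr j (jump ℓ)              = jump (j * L + ℓ)
    copyInstr j (jumpIfZero a ℓ)      = jumpIfZero (cell j a) (j * L + ℓ)
    copyInstr j fail                  = jump (suc j * L)
    copyInstr j (return c e b)        = return (c * t) (cell j e) (cell j b)

  copies : Program → (j m : ℕ) → Program
  copies P j zero    = []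
  copies P j (suc m) = map (copyInstr (length P) j) P ++ copies P (suc j) m

  -- `j` is arbitrary because the induction on `i` drops the first copy, after which the numbering
  -- starts at `suc j`.
  fetch-copies : ∀ P i {j m ℓ a b} → i < m → ℓ < length P →
    fetch (copies P j m) (i * length P + ℓ) a ≡ copyInstr (length P) (j + i) (fetch P ℓ b)
  fetch-copies P zero {j} {suc m} {ℓ} {a} {b} (s≤s i<m) ℓ<
    rewrite +-identityʳ j = trans
      (fetch-++ˡ (map (copyInstr (length P) j) P) _ {i′ = a} (subst (ℓ <_) (sym (length-map _ P)) ℓ<))
      (fetch-map _ P ℓ<)
  fetch-copies P (suc i) {j} {suc m} {ℓ} {a} {b} (s≤s i<m) ℓ< = begin
    fetch (C ++ D) (length P + i * length P + ℓ) a
      ≡⟨ cong (λ n → fetch (C ++ D) n a)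
           (trans (+-assoc (length P) _ ℓ) (cong (_+ (i * length P + ℓ)) (sym (length-map _ P)))) ⟩
    fetch (C ++ D) (length C + (i * length P + ℓ)) a
      ≡⟨ fetch-++ʳ C D ⟩
    fetch D (i * length P + ℓ) a
      ≡⟨ fetch-copies P i i<m ℓ< ⟩
    copyInstr (length P) (suc j + i) (fetch P ℓ b)
      ≡⟨ cong (λ k → copyInstr (length P) k (fetch P ℓ b)) (+-suc j i) ⟨
    copyInstr (length P) (j + suc i) (fetch P ℓ b) ∎
    where
    open ≡-Reasoning
    C = map (copyInstr (length P) j) P
    D = copies P (suc j) m

  -- Simulation of the repeated runs.

  -- `fresh` is carried along so that the later copies find zeroed memory; cells of earlier copies
  -- may hold anything.
  record Simulates (j : ℕ) (M M′ : Memory) : Set where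
    constructor simulates
    field
      agree : ∀ a → M′ (cell j a) ≡ M a
      fresh : ∀ {k} a → j < k → k < t → M′ (cell k a) ≡ 0

  simulates-≔ : ∀ {j M M′} → j < t → Simulates j M M′ → ∀ {d d′ v v′} →
                d′ ≡ cell j d → v′ ≡ v → Simulates j (M [ d ≔ v ]) (M′ [ d′ ≔ v′ ])
  simulates-≔ {j} {M} {M′} j<t (simulates agree fresh) {d} refl refl = simulates agree′
    λ {k} a j<k k<t → trans
      (≔-other M′ (λ eq → <⇒≢ j<k (cell-injectiveʳ {j} {k} {d} {a} j<t k<t (sym eq))))
      (fresh a j<k k<t)
    where
    agree′ : ∀ a → (M′ [ cell j d ≔ _ ]) (cell j a) ≡ (M [ d ≔ _ ]) a
    agree′ a with a ℕ.≟ d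
    ... | yes refl = trans (≔-same M′ (cell j d)) (sym (≔-same M d))
    ... | no  a≢d  = trans (≔-other M′ (a≢d ∘ cell-injectiveˡ j<t))
                           (trans (agree a) (sym (≔-other M a≢d)))

  cell-affine : ∀ j c v e → c * t * v + cell j e ≡ cell j (c * v + e)
  cell-affine j c v e =
    solve 5 (λ j c v e t → c :* t :* v :+ (e :* t :+ j) := (c :* v :+ e) :* t :+ j) refl j c v e t
    where open +-*-Solver

  address-cellAddress : ∀ {j M M′} → Simulates j M M′ → ∀ α →
                        address M′ (cellAddress j α) ≡ cell j (address M α)
  address-cellAddress {j} {M} S (c ·[ a ]+ e) =
    trans (cong (λ v → c * t * v + cell j e) (Simulates.agree S a)) (cell-affine j c (M a) e)

  module _ (P : Program) (x : List Bool) {n} (rs : Vec (Vec Bool n) t) where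

    private
      L = length P
      run′ = runFrom (copies P 0 t) x (interleave rs)

    -- σ is the fuel left over for the copies after j.
    Simulated : Fin t → ℕ → Outcome → Outcome → Set
    Simulated j σ running    o = ⊤
    Simulated j σ (output y) o = o ≡ output y
    Simulated j σ ⊥-out      o = ∃₂ λ τ M′ →
      (∀ {k} a → toℕ j < k → k < t → M′ (cell k a) ≡ 0) ×
      o ≡ run′ (τ + σ) (suc (toℕ j) * L) M′

    -- A jump out of P may land in another copy, but then P itself never halts
    -- and there is nothing to simulate.
    simulate : ∀ j σ τ ℓ {M M′} → Simulates (toℕ j) M M′ →
      Simulated j σ (runFrom P x (toList (lookup rs j)) τ ℓ M)
                    (run′ (τ + σ) (toℕ j * L + ℓ) M′)
    -- The common case of writing one cell and moving on, mutual with `simulate` by recursion on the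
    -- remaining time.
    simulate-≔ : ∀ j σ τ ℓ d v {M M′ d′ v′} → Simulates (toℕ j) M M′ →
      d′ ≡ cell (toℕ j) d → v′ ≡ v →
      Simulated j σ (runFrom P x (toList (lookup rs j)) τ (suc ℓ) (M [ d ≔ v ]))
                    (run′ (τ + σ) (suc (toℕ j * L + ℓ)) (M′ [ d′ ≔ v′ ]))

    simulate j σ zero    ℓ S = tt
    simulate j σ (suc τ) ℓ {M} {M′} S with L ≤? ℓ
    ... | yes L≤ℓ = subst (λ o → Simulated j σ o (run′ (suc τ + σ) (toℕ j * L + ℓ) M′))
                      (sym (runFrom-≥ P x (toList (lookup rs j)) (suc τ) L≤ℓ)) tt
    ... | no  L≰ℓ
      rewrite fetch-copies P (toℕ j) {0} {t} {ℓ} {jump (toℕ j * L + ℓ)} {jump ℓ} (toℕ<n j) (≰⇒> L≰ℓ)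
      with fetch P ℓ (jump ℓ)
    ... | const d m = simulate-≔ j σ τ ℓ d m S refl refl
    ... | add d a b = simulate-≔ j σ τ ℓ d _ S refl (cong₂ _+_ (Simulates.agree S a) (Simulates.agree S b))
    ... | sub d a b = simulate-≔ j σ τ ℓ d _ S refl (cong₂ _∸_ (Simulates.agree S a) (Simulates.agree S b))
    ... | size d    = simulate-≔ j σ τ ℓ d _ S refl refl
    ... | load d α  = simulate-≔ j σ τ ℓ d _ S refl
      (trans (cong M′ (address-cellAddress S α)) (Simulates.agree S (address M α)))
    ... | store α a = simulate-≔ j σ τ ℓ (address M α) _ S (address-cellAddress S α) (Simulates.agree S a)
    ... | input d (c ·[ a ]+ e) = simulate-≔ j σ τ ℓ d _ S refl
      (cong (λ v → bitAt x (c * v + e)) (Simulates.agree S a))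
    ... | aux d α = simulate-≔ j σ τ ℓ d _ S refl
      (trans (cong (bitAt (interleave rs)) (address-cellAddress S α))
             (bitAt-interleave rs j (address M α)))
    ... | jump ℓ′ = simulate j σ τ ℓ′ S
    ... | jumpIfZero a ℓ′ rewrite Simulates.agree S a with M a ≡ᵇ 0
    ...   | true  = simulate j σ τ ℓ′ S
    ...   | false = subst (λ ℓ″ → Simulated j σ (runFrom P x (toList (lookup rs j)) τ (suc ℓ) M) (run′ (τ + σ) ℓ″ M′))
                      (+-suc (toℕ j * L) ℓ) (simulate j σ τ (suc ℓ) S)
    -- The copied `fail` is a jump that takes one unit and leaves `τ` units of this copy's share.
    simulate j σ (suc τ) ℓ {M} {M′} S | no _ | fail = τ , M′ , Simulates.fresh S , refl
    simulate j σ (suc τ) ℓ {M} {M′} S | no _ | return c e b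
      rewrite Simulates.agree S b with M b ≤ᵇ τ in eq
    ... | false = tt
    -- The copy has `σ` more units than the original, so its `return` has time to finish as well.
    ... | true with M b ≤ᵇ τ + σ | ≤⇒≤ᵇ (≤-trans (≤ᵇ⇒≤ (M b) τ (subst T (sym eq) tt)) (m≤m+n τ σ))
    ...   | true | _ = cong output (map-cong
      (λ k → cong (λ v → if v ≡ᵇ 0 then false else true)
        (trans (cong M′ (cell-affine (toℕ j) c k e)) (Simulates.agree S (c * k + e))))
      (upTo (M b)))

    simulate-≔ j σ τ ℓ d v {M} {M′} {d′} {v′} S d≡ v≡ =
      subst (λ ℓ′ → Simulated j σ (runFrom P x (toList (lookup rs j)) τ (suc ℓ) (M [ d ≔ v ]))
                                  (run′ (τ + σ) ℓ′ (M′ [ d′ ≔ v′ ])))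
        (+-suc (toℕ j * L) ℓ)
        (simulate j σ τ (suc ℓ) (simulates-≔ (toℕ<n j) S d≡ v≡))

    -- Induction on `m`, the number of copies from copy `i` on. Each takes at most `T` units, so
    -- `T * m` units suffice. By `i ≤ toℕ k` the successful copy `k` has not been passed, so the
    -- copies cannot run out. If an earlier copy returns an output first, `correct` applies to it.
    first-success : ∀ {ℓ} {Correct : List Bool → Set ℓ} T →
      (∀ j → run P x (toList (lookup rs j)) T ≢ running) →
      (∀ j {y} → run P x (toList (lookup rs j)) T ≡ output y → Correct y) →
      ∀ k {y} → run P x (toList (lookup rs k)) T ≡ output y →
      ∀ m i {τ M′} → i + m ≡ t → T * m ≤ τ → i ≤ toℕ k →
      (∀ {j} a → i ≤ j → j < t → M′ (cell j a) ≡ 0) →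
      ∃ λ y → run′ τ (i * L) M′ ≡ output y × Correct y
    first-success T halts correct k succ zero i i+0≡t T*m≤τ i≤k fresh =
      contradiction (subst (_≤ toℕ k) (trans (sym (+-identityʳ i)) i+0≡t) i≤k) (<⇒≱ (toℕ<n k))
    first-success {Correct = Correct} T halts correct k succ (suc m) i {τ} {M′} i+m≡t T*m≤τ i≤k fresh =
      -- Copy `i` gets `T` of the `τ` units, enough for it to halt; the other `σ` are for the later
      -- copies.
      continue out refl (subst₂ (λ τ ℓ → Simulated j σ out (run′ τ ℓ M′))
        (m+[n∸m]≡n (m+n≤o⇒m≤o T T+T*m≤τ))
        (trans (+-identityʳ _) (cong (_* L) j≡i))
        (simulate j σ T 0 (subst (λ i → Simulates i (λ _ → 0) M′) (sym j≡i)
          (simulates (λ a → fresh a ≤-refl i<t) (λ a → fresh a ∘ <⇒≤)))))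
      where
      i<t : i < t
      i<t = ≤-<-trans i≤k (toℕ<n k)
      j = fromℕ< i<t
      j≡i : toℕ j ≡ i
      j≡i = toℕ-fromℕ< i<t
      out = run P x (toList (lookup rs j)) T
      T+T*m≤τ : T + T * m ≤ τ
      T+T*m≤τ = subst (_≤ τ) (*-suc T m) T*m≤τ
      σ = τ ∸ T
      -- Copy `i` failed and copy `k` does not, so `i` differs from `k`.
      later : out ≡ ⊥-out → i < toℕ k
      later eq with m≤n⇒m<n∨m≡n i≤k
      ... | inj₁ i<k = i<k
      ... | inj₂ i≡k with () ← trans (sym eq) (subst (λ k → run P x (toList (lookup rs k)) T ≡ output _)
                                  (toℕ-injective (sym (trans j≡i i≡k))) succ)
      continue : ∀ o → out ≡ o → Simulated j σ o (run′ τ (i * L) M′) →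
                 ∃ λ y → run′ τ (i * L) M′ ≡ output y × Correct y
      continue running    eq _   = contradiction eq (halts j)
      continue (output y) eq sim = y , sim , correct j eq
      continue ⊥-out eq (τ′ , M″ , fresh″ , sim) =
        let y , run≡ , ok = first-success {Correct = Correct} T halts correct k succ m (suc i)
              (trans (sym (+-suc i m)) i+m≡t)
              -- `τ′ + σ` is at least `σ`, that is `τ ∸ T`, hence at least `T * m`.
              (≤-trans (subst (_≤ σ) (m+n∸m≡n T (T * m)) (∸-monoˡ-≤ T T+T*m≤τ)) (m≤n+m σ τ′))
              (later eq)
              (λ a → fresh″ a ∘ subst (_< _) (sym j≡i))
        in y , trans sim (trans (cong (λ i → run′ (τ′ + σ) (suc i * L) M″) j≡i) run≡) , ok

-- Coins shared by all inputs of one size, used as advice.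

theorem3p2 : ∀ {ℓ} (t : ℕ) .{{_ : NonZero t}} (T s : ℕ → ℕ) (ε : ℕ → ℝ) →
    (∀ N → (fromℚ 0ℚ ≤ᴿ ε N) × (ε N ≤ᴿ fromℚ 1ℚ)) →
    (∀ N → ε N <ᴿ 2^-[ s N / t ]) →
    (Π : Problem ℓ) (A : LasVegas Π T) →
    ObliviousVerifier A s ε →
    NonUniform Π (λ N → T N * t)
theorem3p2 t T s ε _ ε< Π A V = record
  { program     = copies t A.program 0 t
  ; advice      = λ N → interleave (coins N)
  ; advice-size = λ N → subst (_≤ T N * t) (sym (length-interleave (coins N)))
                          (*-monoˡ-≤ t (A.coins≤time N))
  ; correct     = correct
  }
  where
  module A = LasVegas A
  module V = ObliviousVerifier V

  -- The coins are chosen from `N` alone, before `x`, as advice has to be.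
  good-coins : ∀ N → ∃ λ (rs : Vec (Vec Bool (A.coins N)) t) →
               ∀ (x : Vec Bool N) → ∃ λ j → V.rejects N (V.sketch x) (lookup rs j) ≡ false
  good-coins N =
    let a , b , lt , bound = fraction-below-2^- t (s N) {ε N} (ε< N)
        rs , hits = common-coins a b (V.rejects N) lt
    in rs , λ x → hits (V.sketch x) (bound (A.coins N) (V.rejects N (V.sketch x)) (V.error x))

  coins : ∀ N → Vec (Vec Bool (A.coins N)) t
  coins N = proj₁ (good-coins N)

  correct : ∀ {N} (x : Vec Bool N) → ∃ λ y →
            run (copies t A.program 0 t) (toList x) (interleave (coins N)) (T N * t) ≡ output y × Π x y
  correct {N} x =
    let j , accepts = proj₂ (good-coins N) x
        _ , succeeds = V.sound x (lookup (coins N) j) accepts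
    in first-success t A.program (toList x) (coins N) {Correct = Π x} (T N)
         (λ j → A.halts x (lookup (coins N) j))
         (λ j → A.correct x (lookup (coins N) j))
         -- At the start all `t` copies are ahead, the time is exactly `T N * t`, and every cell is
         -- 0.
         j succeeds t 0 refl ≤-refl z≤n (λ _ _ _ → refl)
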